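{- Let $k\ge 0$ be an integer and let $G$ be an outer min-$k$-planar graph. Then the separation number of $G$ satisfies $\operatorname{sn}(G) \leq 2\cdot\lfloor k/2\rfloor + 4$.
   Context: Graphs are finite, simple and undirected. A convex drawing of a graph is a straight-line drawing in which the vertices are placed on distinct points of a circle. Given the resulting cyclic order $(v_1,\ldots,v_n)$ of the vertices, an edge $v_iv_j$ with $i<j$ crosses an edge $v_{i'}v_{j'}$ with $i'<j'$ if either $1\le i<i'<j<j'\le n$ or $1\le i'<i<j'<j\le n$. Only convex drawings in which no three pairwise non-adjacent edges pass through the same point are considered. An outer min-$k$-planar drawing is a convex drawing such that for every crossing of two edges, at least one of these two edges crosses at most $k$ other edges; a graph is outer min-$k$-planar if it admits an outer min-$k$-planar drawing. A separation of a graph $G$ is a pair $(A,B)$ of subsets of $V(G)$ such that $A\cup B=V(G)$ and there are no edges between $A\setminus B$ and $B\setminus A$. Its order is $|A\cap B|$. It is balanced if $|A\setminus B|\le \frac23|V(G)|$ and $|B\setminus A|\le\frac23|V(G)|$. The separation number $\operatorname{sn}(G)$ is the minimum integer $a$ such that every subgraph of $G$ has a balanced separation of order at most $a$. -}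

module Defs where

open import Data.Fin.Base using (Fin; _<_)
open import Data.Fin.Properties using (all?) renaming (_<?_ to _<ᶠ?_)
open import Data.Fin.Subset
  using (Subset; inside; outside; _∈_; _⊆_; _∪_; _∩_; _─_; ∣_∣)
open import Data.Fin.Subset.Properties
  using (_∈?_; _⊆?_; anySubset?; ∣p∣≤n; ∪-idem)
open import Data.Bool.Properties using () renaming (_≟_ to _≟ᵇ_)
open import Data.List.Base using (List; length; filter; cartesianProduct; allFin)
open import Data.Nat.Base using (ℕ; zero; suc; _*_; _≤_; z≤n; s≤s)
open import Data.Nat.Properties using (_≤?_)
open import Data.Product.Base using (Σ; ∃; ∃-syntax; _×_; _,_; proj₁; proj₂)
open import Data.Sum.Base using (_⊎_)
open import Data.Vec.Base using ([]; _∷_; there)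
open import Data.Vec.Properties using (≡-dec)
open import Function.Base using (_∘_)
open import Function.Definitions using (Injective)
open import Level using (0ℓ)
open import Relation.Binary.Core using (Rel)
open import Relation.Binary.Definitions using (Decidable; Symmetric)
open import Relation.Binary.PropositionalEquality
  using (_≡_; refl; sym; subst)
open import Relation.Nullary.Decidable
  using (Dec; yes; no; _×-dec_; _⊎-dec_; _→-dec_; ¬?; map′; decidable-stable)
open import Relation.Nullary.Negation using (¬_; contradiction)
import Relation.Unary as U

-- A finite simple graph whose vertices are drawn from the universe Fin n.  The
-- vertex set is an arbitrary subset of that universe, so that a subgraph of G
-- is again a Graph n.
record Graph (n : ℕ) : Set₁ where
  field
    V      : Subset n
    Adj    : Rel (Fin n) 0ℓ
    adj?   : Decidable Adj
    symm   : Symmetric Adj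
    irrefl : ∀ {x} → ¬ Adj x x
    adj⇒∈V : ∀ {x y} → Adj x y → x ∈ V

open Graph public

infix 4 _IsSubgraphOf_

_IsSubgraphOf_ : ∀ {n} → Graph n → Graph n → Set
H IsSubgraphOf G = V H ⊆ V G × (∀ {x y} → Adj H x y → Adj G x y)

-- A convex drawing, recorded by the order (v₁ , … , v_m) of the vertices along
-- the circle, read off from an arbitrary starting point; m is the number of
-- vertices.  Crossings depend only on this order, and every order is realised
-- by a drawing in which no three pairwise non-adjacent edges meet in a point.
record ConvexDrawing {n : ℕ} (G : Graph n) : Set where
  field
    vertexAt   : Fin ∣ V G ∣ → Fin n
    injective  : Injective _≡_ _≡_ vertexAt
    sound      : ∀ i → vertexAt i ∈ V G
    exhaustive : ∀ {x} → x ∈ V G → ∃[ i ] vertexAt i ≡ x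

-- The pair of positions (i , j) with i < j stands for the (potential) edge
-- vᵢvⱼ.
Crosses : ∀ {m} → Rel (Fin m × Fin m) 0ℓ
Crosses (i , j) (i′ , j′) =
  (i < i′ × i′ < j × j < j′) ⊎ (i′ < i × i < j′ × j′ < j)

crosses? : ∀ {m} → Decidable (Crosses {m})
crosses? (i , j) (i′ , j′) =
  ((i <ᶠ? i′) ×-dec (i′ <ᶠ? j) ×-dec (j <ᶠ? j′)) ⊎-dec
  ((i′ <ᶠ? i) ×-dec (i <ᶠ? j′) ×-dec (j′ <ᶠ? j))

module _ {n : ℕ} {G : Graph n} (D : ConvexDrawing G) where
  open ConvexDrawing D

  IsEdge : U.Pred (Fin ∣ V G ∣ × Fin ∣ V G ∣) 0ℓ
  IsEdge (i , j) = i < j × Adj G (vertexAt i) (vertexAt j)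

  isEdge? : U.Decidable IsEdge
  isEdge? (i , j) = (i <ᶠ? j) ×-dec adj? G (vertexAt i) (vertexAt j)

  edges : List (Fin ∣ V G ∣ × Fin ∣ V G ∣)
  edges = filter isEdge? (cartesianProduct (allFin _) (allFin _))

  -- An edge never crosses itself, so this counts other edges only.
  crossings : Fin ∣ V G ∣ × Fin ∣ V G ∣ → ℕ
  crossings e = length (filter (crosses? e) edges)

  IsMinPlanar : ℕ → Set
  IsMinPlanar k = ∀ e f → IsEdge e → IsEdge f → Crosses e f →
    crossings e ≤ k ⊎ crossings f ≤ k

OuterMinPlanar : ∀ {n} → ℕ → Graph n → Set
OuterMinPlanar k G = Σ (ConvexDrawing G) λ D → IsMinPlanar D k

record IsSeparation {n : ℕ} (G : Graph n) (A B : Subset n) : Set where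
  constructor mkSeparation
  field
    cover  : A ∪ B ≡ V G
    noEdge : ∀ {x y} → x ∈ A ─ B → y ∈ B ─ A → ¬ Adj G x y

IsBalanced : ∀ {n} → Graph n → Subset n → Subset n → Set
IsBalanced G A B =
  3 * ∣ A ─ B ∣ ≤ 2 * ∣ V G ∣ × 3 * ∣ B ─ A ∣ ≤ 2 * ∣ V G ∣

HasBalancedSeparation : ∀ {n} → Graph n → ℕ → Set
HasBalancedSeparation G a = ∃[ A ] ∃[ B ]
  (IsSeparation G A B × IsBalanced G A B × ∣ A ∩ B ∣ ≤ a)

SubgraphsHaveBalancedSeparation : ∀ {n} → Graph n → ℕ → Set₁
SubgraphsHaveBalancedSeparation {n} G a =
  (H : Graph n) → H IsSubgraphOf G → HasBalancedSeparation H a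

IsMinimum : ∀ {ℓ} → U.Pred ℕ ℓ → ℕ → Set ℓ
IsMinimum P a = P a × (∀ b → P b → a ≤ b)

minimum : ∀ {ℓ} {P : U.Pred ℕ ℓ} → U.Decidable P → ∀ m → P m → ∃ (IsMinimum P)
minimum P? zero    p = zero , p , λ _ _ → z≤n
minimum P? (suc m) p with P? zero
... | yes p₀ = zero , p₀ , λ _ _ → z≤n
... | no ¬p₀ with minimum (P? ∘ suc) m p
...   | a , pa , least = suc a , pa , λ where
        zero    p₀ → contradiction p₀ ¬p₀
        (suc b) pb → s≤s (least b pb)

isSeparation? : ∀ {n} (G : Graph n) → Decidable (IsSeparation G)
isSeparation? G A B = map′
  (λ (c , s) → mkSeparation c (λ {x} {y} → s x y))
  (λ (mkSeparation c s) → c , λ x y → s {x} {y})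
  (≡-dec _≟ᵇ_ (A ∪ B) (V G) ×-dec
   all? λ x → all? λ y →
     (x ∈? (A ─ B)) →-dec ((y ∈? (B ─ A)) →-dec ¬? (adj? G x y)))

hasBalancedSeparation? : ∀ {n} (G : Graph n) → U.Decidable (HasBalancedSeparation G)
hasBalancedSeparation? G a = anySubset? λ A → anySubset? λ B →
  isSeparation? G A B ×-dec
  ((3 * ∣ A ─ B ∣ ≤? 2 * ∣ V G ∣) ×-dec (3 * ∣ B ─ A ∣ ≤? 2 * ∣ V G ∣)) ×-dec
  (∣ A ∩ B ∣ ≤? a)

-- A subgraph of G in the sense of _IsSubgraphOf_ only when W ⊆ V G.
induced : ∀ {n} → Graph n → Subset n → Graph n
induced G W = record
  { V      = W
  ; Adj    = λ x y → Adj G x y × x ∈ W × y ∈ W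
  ; adj?   = λ x y → adj? G x y ×-dec (x ∈? W) ×-dec (y ∈? W)
  ; symm   = λ (e , x∈W , y∈W) → symm G e , y∈W , x∈W
  ; irrefl = λ (e , _) → irrefl G e
  ; adj⇒∈V = λ (_ , x∈W , _) → x∈W
  }

-- A separation of the subgraph induced on V H is a separation of H, so it
-- suffices to inspect the finitely many induced subgraphs.
subgraphsHaveBalancedSeparation? :
  ∀ {n} (G : Graph n) → U.Decidable (SubgraphsHaveBalancedSeparation G)
subgraphsHaveBalancedSeparation? {n} G a = map′ fromInduced toInduced inducedOnes?
  where
  InducedOne : U.Pred (Subset n) 0ℓ
  InducedOne W = W ⊆ V G → HasBalancedSeparation (induced G W) a

  inducedOne? : U.Decidable InducedOne
  inducedOne? W = (W ⊆? V G) →-dec hasBalancedSeparation? (induced G W) a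

  inducedOnes? : Dec (∀ W → InducedOne W)
  inducedOnes? = map′
    (λ none W → decidable-stable (inducedOne? W) (λ bad → none (W , bad)))
    (λ every (W , bad) → bad (every W))
    (¬? (anySubset? (¬? ∘ inducedOne?)))

  fromInduced : (∀ W → InducedOne W) → SubgraphsHaveBalancedSeparation G a
  fromInduced every H (V⊆ , Adj⊆) with every (V H) V⊆
  ... | A , B , mkSeparation c s , balanced , order =
    A , B , mkSeparation c (λ x∈ y∈ e →
      s x∈ y∈ (Adj⊆ e , adj⇒∈V H e , adj⇒∈V H (symm H e))) , balanced , order

  toInduced : SubgraphsHaveBalancedSeparation G a → ∀ W → InducedOne W
  toInduced every W W⊆ = every (induced G W) (W⊆ , proj₁)

-- The separation (V H , V H) has order at most n.
subgraphsHaveBalancedSeparation-n :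
  ∀ {n} (G : Graph n) → SubgraphsHaveBalancedSeparation G n
subgraphsHaveBalancedSeparation-n {n} G H _ =
  V H , V H ,
  mkSeparation (∪-idem (V H)) (λ x∈ _ _ → x∉p─p (V H) x∈) ,
  (small , small) ,
  ∣p∣≤n (V H ∩ V H)
  where
  x∉p─p : ∀ {m} (p : Subset m) {x : Fin m} → ¬ (x ∈ p ─ p)
  x∉p─p (inside ∷ p)  (there x∈) = x∉p─p p x∈
  x∉p─p (outside ∷ p) (there x∈) = x∉p─p p x∈

  ∣p─p∣≡0 : ∀ {m} (p : Subset m) → ∣ p ─ p ∣ ≡ 0
  ∣p─p∣≡0 []                          = refl
  ∣p─p∣≡0 (inside ∷ p)  = ∣p─p∣≡0 p
  ∣p─p∣≡0 (outside ∷ p) = ∣p─p∣≡0 p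

  small : 3 * ∣ V H ─ V H ∣ ≤ 2 * ∣ V H ∣
  small = subst (λ z → 3 * z ≤ 2 * ∣ V H ∣) (sym (∣p─p∣≡0 (V H))) z≤n

separationNumber : ∀ {n} (G : Graph n) → ∃ (IsMinimum (SubgraphsHaveBalancedSeparation G))
separationNumber {n} G = minimum (subgraphsHaveBalancedSeparation? G) n
  (subgraphsHaveBalancedSeparation-n G)

sn : ∀ {n} → Graph n → ℕ
sn G = proj₁ (separationNumber G)

sn-isMinimum : ∀ {n} (G : Graph n) → IsMinimum (SubgraphsHaveBalancedSeparation G) (sn G)
sn-isMinimum G = proj₂ (separationNumber G)

{-# OPTIONS --safe #-}

-- Clone every vertex so that each clone carries at most one edge, keep the clones on the
-- diagonal x = y, and draw every edge as an L-shaped path above the diagonal; two edges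
-- then meet exactly when they cross, and every lattice point lies on at most two edges.
-- From a lattice point on an edge with at most k crossings, the cheaper half of that edge
-- leads to a vertex and crosses at most ⌊k/2⌋ further edges.  Edges with more than k
-- crossings do not cross each other, so any other lattice point can first follow the single
-- edge through it (or a vertical line free of edges).  This is a path from every lattice
-- point to a vertex that meets only edges covered by some ⌊k/2⌋ + 2 vertices.
--
-- Cut the circular order into three parts of equal weight and colour a lattice point by the
-- part in which its path ends.  Sperner's lemma yields three neighbouring points of distinct
-- colours; no edge passes between neighbouring points, so the paths of any two of them form
-- a separator of order 2⌊k/2⌋ + 4, and one of the three pairs is balanced.
module Submission where

open import Defs
open import Data.Bool.Base using (Bool; true; false; _xor_)
open import Data.Bool.Properties using (xor-identityʳ)
open import Data.Empty using (⊥)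
open import Data.Fin.Base using (Fin; toℕ; fromℕ<)
open import Data.Fin.Properties using (toℕ<n; toℕ-injective; fromℕ<-toℕ; toℕ-fromℕ<)
open import Data.Fin.Subset
  using (Subset; inside; outside; _∈_; _∉_; _⊆_; _∪_; _∩_; _─_; ∣_∣; ⁅_⁆; ⋃) renaming (⊥ to ∅)
open import Data.Fin.Subset.Properties
  using (∣⊥∣≡0; x∈⁅x⁆; x∈⁅y⁆⇒x≡y; ∣⁅x⁆∣≡1; p⊆q⇒∣p∣≤∣q∣; p∩q⊆p; p∩q⊆q; x∈p∩q⁺; x∈p∩q⁻;
         ∣p∩q∣≤∣p∣; ∣p∩q∣≤∣q∣; p⊆p∪q; q⊆p∪q; x∈p∪q⁺; x∈p∪q⁻; p─q⊆p; x∈p∧x∉q⇒x∈p─q; ⊆-antisym)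
  renaming (∉⊥ to ∉∅)
open import Data.List.Base using (List; []; _∷_; _++_; length; filter; map; cartesianProduct; allFin)
open import Data.List.Membership.Propositional using (find; lose) renaming (_∈_ to _∈ˡ_)
open import Data.List.Membership.Propositional.Properties
  using (∈-filter⁺; ∈-filter⁻; ∈-map⁺; ∈-++⁺ˡ; ∈-++⁺ʳ; ∈-cartesianProduct⁺; ∈-allFin)
open import Data.List.Properties using (length-map; length-++)
open import Data.List.Relation.Unary.Any using (here; there; any?)
open import Data.Nat.Base
open import Data.Nat.DivMod using (_/_; m*n/n≡m; /-monoˡ-≤; +-distrib-/-∣ˡ; m<n⇒m/n≡0; n/n≡1)
open import Data.Nat.Divisibility using (n∣m*n; ∣-refl)
open import Data.Nat.Properties
open import Data.Nat.Solver using (module +-*-Solver)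
open import Data.Product.Base using (_×_; _,_; proj₁; proj₂; ∃-syntax)
open import Data.Sum.Base using (_⊎_; inj₁; inj₂; [_,_]′)
open import Data.Vec.Base using ([]; _∷_; here; there)
open import Function.Base using (id)
open import Relation.Binary.Definitions using (Tri; tri<; tri≈; tri>)
open import Relation.Binary.PropositionalEquality
  using (_≡_; _≢_; refl; sym; trans; cong; cong₂; subst; subst₂; module ≡-Reasoning)
open import Relation.Nullary.Decidable using (Dec; yes; no; does; _×-dec_; _⊎-dec_; ¬?; decidable-stable)
open import Relation.Nullary.Negation using (¬_; contradiction)

-- Counting in lists and halving.

length-filter-split : ∀ {A : Set} {P : A → Set} (P? : ∀ x → Dec (P x)) (xs : List A) →
  length (filter P? xs) + length (filter (λ x → ¬? (P? x)) xs) ≡ length xs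
length-filter-split P? [] = refl
length-filter-split P? (x ∷ xs) with does (P? x)
... | true  = cong suc (length-filter-split P? xs)
... | false = trans (+-suc _ _) (cong suc (length-filter-split P? xs))

-- The smaller summand, doubled, is at most `k`. This picks the cheaper half of an edge with at most
-- `k` crossings.
+-≤-halves : ∀ {i j k} → i + j ≤ k → i ≤ ⌊ k /2⌋ ⊎ j ≤ ⌊ k /2⌋
+-≤-halves {i} {j} {k} i+j≤k with ≤-total i j
... | inj₁ i≤j = inj₁ (subst (_≤ ⌊ k /2⌋) (sym (n≡⌊n+n/2⌋ i))
                   (⌊n/2⌋-mono (≤-trans (+-monoʳ-≤ i i≤j) i+j≤k)))
... | inj₂ j≤i = inj₂ (subst (_≤ ⌊ k /2⌋) (sym (n≡⌊n+n/2⌋ j))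
                   (⌊n/2⌋-mono (≤-trans (+-monoˡ-≤ j j≤i) i+j≤k)))

-- Clones of vertices and the L-shaped drawing of chords.

module Chords (m : ℕ) where

  Chord : Set
  Chord = Fin m × Fin m

  left right : Chord → ℕ
  left (i , _) = toℕ i
  right (_ , j) = toℕ j

  vertex : ℕ → ℕ
  vertex x = x / suc m

  -- Vertex i owns the block of clones [ i * suc m , (i + 1) * suc m ).  Within a block the
  -- clones are ordered so that chords with a common endpoint do not interleave.
  start stop : Chord → ℕ
  start e = left e * suc m + (left e + (suc m ∸ right e))
  stop  e = right e * suc m + (right e ∸ left e)

  top : ℕ
  top = m * suc m

  Proper : Chord → Set
  Proper e = left e < right e

  vertex-block : ∀ i {c} → c < suc m → vertex (i * suc m + c) ≡ i
  vertex-block i {c} c<M = trans (+-distrib-/-∣ˡ c (n∣m*n i))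
    (trans (cong₂ _+_ (m*n/n≡m i (suc m)) (m<n⇒m/n≡0 c<M)) (+-identityʳ i))

  vertex-mono : ∀ {x y} → x ≤ y → vertex x ≤ vertex y
  vertex-mono = /-monoˡ-≤ (suc m)

  vertex-suc : ∀ x → vertex (suc x) ≤ suc (vertex x)
  vertex-suc x = ≤-trans (vertex-mono (+-monoˡ-≤ x (s≤s z≤n)))
    (≤-reflexive (trans (+-distrib-/-∣ˡ x ∣-refl) (cong (_+ vertex x) (n/n≡1 (suc m)))))

  vertex-top : vertex top ≡ m
  vertex-top = m*n/n≡m m (suc m)

  right<m : ∀ e → right e < m
  right<m (_ , j) = toℕ<n j

  vertex-start : ∀ e → Proper e → vertex (start e) ≡ left e
  vertex-start e l<r = vertex-block (left e)
    (≤-trans (+-monoˡ-≤ (suc m ∸ right e) l<r)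
      (≤-reflexive (m+[n∸m]≡n (m≤n⇒m≤1+n (<⇒≤ (right<m e))))))

  vertex-stop : ∀ e → vertex (stop e) ≡ right e
  vertex-stop e = vertex-block (right e)
    (≤-trans (s≤s (m∸n≤m (right e) (left e))) (m≤n⇒m≤1+n (right<m e)))

  -- Offsets of starts are positive because `right e < suc m`. The column `x = 0` is therefore
  -- outside every chord.
  0<start : ∀ e → 0 < start e
  0<start e = ≤-trans (≤-trans (m<n⇒0<n∸m (m≤n⇒m≤1+n (right<m e))) (m≤n+m _ (left e)))
    (m≤n+m _ (left e * suc m))

  stop<top : ∀ e → stop e < top
  stop<top e = ≤-trans (≤-trans (≤-reflexive (sym (+-suc _ _)))
      (≤-trans (+-monoʳ-≤ (right e * suc m)
        (s≤s (≤-trans (m∸n≤m (right e) (left e)) (<⇒≤ (right<m e)))))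
      (≤-reflexive (+-comm (right e * suc m) (suc m)))))
    (*-monoˡ-≤ (suc m) (right<m e))

  chord-≡ : ∀ {e f : Chord} → left e ≡ left f → right e ≡ right f → e ≡ f
  chord-≡ l≡ r≡ = cong₂ _,_ (toℕ-injective l≡) (toℕ-injective r≡)

  -- The block of the clone determines `left`, and the offset in the block then determines `right`.
  -- Hence each vertical line carries at most one chord; `stop-injective` does the same for
  -- horizontal lines.
  start-injective : ∀ {e f} → Proper e → Proper f → start e ≡ start f → e ≡ f
  start-injective {e} {f} pe pf eq = chord-≡ l≡
      (∸-cancelˡ-≡ (m≤n⇒m≤1+n (<⇒≤ (right<m e))) (m≤n⇒m≤1+n (<⇒≤ (right<m f)))
        (+-cancelˡ-≡ (left e) _ _ (+-cancelˡ-≡ (left e * suc m) _ _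
          (subst (λ l → start e ≡ l * suc m + (l + (suc m ∸ right f))) (sym l≡) eq))))
    where
    l≡ : left e ≡ left f
    l≡ = trans (sym (vertex-start e pe)) (trans (cong vertex eq) (vertex-start f pf))

  stop-injective : ∀ {e f} → Proper e → Proper f → stop e ≡ stop f → e ≡ f
  stop-injective {e} {f} pe pf eq = chord-≡
      (∸-cancelˡ-≡ (<⇒≤ pe) (subst (left f ≤_) (sym r≡) (<⇒≤ pf))
        (+-cancelˡ-≡ (right e * suc m) _ _
          (subst (λ r → stop e ≡ r * suc m + (r ∸ left f)) (sym r≡) eq)))
      r≡
    where
    r≡ : right e ≡ right f
    r≡ = trans (sym (vertex-stop e)) (trans (cong vertex eq) (vertex-stop f))

  start≤start⇒ : ∀ {e f} → Proper e → Proper f → start e ≤ start f → left e ≤ left f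
  start≤start⇒ {e} {f} pe pf le = subst₂ _≤_ (vertex-start e pe) (vertex-start f pf) (vertex-mono le)

  start≤stop⇒ : ∀ {e f} → Proper e → start e ≤ stop f → left e ≤ right f
  start≤stop⇒ {e} {f} pe le = subst₂ _≤_ (vertex-start e pe) (vertex-stop f) (vertex-mono le)

  stop≤start⇒ : ∀ {e f} → Proper f → stop e ≤ start f → right e ≤ left f
  stop≤start⇒ {e} {f} pf le = subst₂ _≤_ (vertex-stop e) (vertex-start f pf) (vertex-mono le)

  stop≤stop⇒ : ∀ {e f} → stop e ≤ stop f → right e ≤ right f
  stop≤stop⇒ {e} {f} le = subst₂ _≤_ (vertex-stop e) (vertex-stop f) (vertex-mono le)

  -- Passing to blocks gives weak inequalities. Equality is excluded by the order inside a block: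
  -- stops precede starts, starts are sorted by decreasing `right`, and stops by decreasing `left`.
  interleave⇒ : ∀ {e f} → Proper e → Proper f →
    start e < start f → start f < stop e → stop e < stop f →
    left e < left f × left f < right e × right e < right f
  interleave⇒ {e} {f} pe pf ss st tt =
      ≤∧≢⇒< l≤l l≢l
    , ≤∧≢⇒< (start≤stop⇒ {f} {e} pf (<⇒≤ st)) l≢r
    , ≤∧≢⇒< r≤r r≢r
    where
    l≤l = start≤start⇒ {e} {f} pe pf (<⇒≤ ss)
    r≤r = stop≤stop⇒ {e} {f} (<⇒≤ tt)

    l≢l : left e ≢ left f
    l≢l eq = <⇒≱ ss (≤-trans
      (+-monoʳ-≤ (left f * suc m) (+-monoʳ-≤ (left f) (∸-monoʳ-≤ (suc m) r≤r)))
      (≤-reflexive (cong (λ l → l * suc m + (l + (suc m ∸ right e))) (sym eq))))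

    r≢r : right e ≢ right f
    r≢r eq = <⇒≱ tt (≤-trans
      (+-monoʳ-≤ (right f * suc m) (∸-monoʳ-≤ (right f) l≤l))
      (≤-reflexive (cong (λ r → r * suc m + (r ∸ left e)) (sym eq))))

    l≢r : left f ≢ right e
    l≢r eq = <⇒≱ st (≤-trans
      (+-monoʳ-≤ (right e * suc m) (≤-trans (m∸n≤m (right e) (left e))
        (≤-trans (≤-reflexive (sym eq)) (m≤m+n (left f) _))))
      (≤-reflexive (cong (λ l → l * suc m + (left f + (suc m ∸ right f))) (sym eq))))

  -- The chord e is drawn as the vertical segment x = start e followed by the
  -- horizontal segment y = stop e, above the diagonal that carries the vertices.
  Inside Outside On : Chord → ℕ → ℕ → Set
  Inside  e x y = start e < x × y < stop e
  Outside e x y = x < start e ⊎ stop e < y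
  On      e x y = start e ≤ x × y ≤ stop e × (x ≡ start e ⊎ y ≡ stop e)

  Within Beyond : Chord → ℕ → Set
  Within e a = left e < a × a < right e
  Beyond e a = a < left e ⊎ right e < a

  -- This stands for a path from `(x, y)` to the vertex `a` that avoids the chord `e`: only the
  -- common side of its two ends is recorded.
  Agree : Chord → ℕ → ℕ → ℕ → Set
  Agree e x y a = (Inside e x y × Within e a) ⊎ (Outside e x y × Beyond e a)

  on? : ∀ e x y → Dec (On e x y)
  on? e x y = (start e ≤? x) ×-dec (y ≤? stop e) ×-dec ((x ≟ start e) ⊎-dec (y ≟ stop e))

  agree? : ∀ e x y a → Dec (Agree e x y a)
  agree? e x y a =
    (((start e <? x) ×-dec (y <? stop e)) ×-dec ((left e <? a) ×-dec (a <? right e))) ⊎-dec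
    (((x <? start e) ⊎-dec (stop e <? y)) ×-dec ((a <? left e) ⊎-dec (right e <? a)))

  data Region (e : Chord) (x y : ℕ) : Set where
    isInside  : Inside e x y → Region e x y
    isOutside : Outside e x y → Region e x y
    isOn      : On e x y → Region e x y

  side : ∀ e x y → Region e x y
  side e x y with <-cmp x (start e) | <-cmp y (stop e)
  ... | tri< x<s _ _ | _            = isOutside (inj₁ x<s)
  ... | tri≈ _ _ _   | tri> _ _ t<y = isOutside (inj₂ t<y)
  ... | tri> _ _ _   | tri> _ _ t<y = isOutside (inj₂ t<y)
  ... | tri≈ _ x≡s _ | tri< y<t _ _ = isOn (≤-reflexive (sym x≡s) , <⇒≤ y<t , inj₁ x≡s)
  ... | tri≈ _ x≡s _ | tri≈ _ y≡t _ = isOn (≤-reflexive (sym x≡s) , ≤-reflexive y≡t , inj₁ x≡s)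
  ... | tri> _ _ s<x | tri≈ _ y≡t _ = isOn (<⇒≤ s<x , ≤-reflexive y≡t , inj₂ y≡t)
  ... | tri> _ _ s<x | tri< y<t _ _ = isInside (s<x , y<t)

  ¬inside∧on : ∀ e {x y} → Inside e x y → ¬ On e x y
  ¬inside∧on e (s<x , y<t) (_ , _ , inj₁ x≡s) = <⇒≢ s<x (sym x≡s)
  ¬inside∧on e (s<x , y<t) (_ , _ , inj₂ y≡t) = <⇒≢ y<t y≡t

  ¬outside∧on : ∀ e {x y} → Outside e x y → ¬ On e x y
  ¬outside∧on e (inj₁ x<s) (s≤x , _) = <⇒≱ x<s s≤x
  ¬outside∧on e (inj₂ t<y) (_ , y≤t , _) = <⇒≱ t<y y≤t

  Near : ℕ → ℕ → ℕ → ℕ → Set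
  Near x y x′ y′ = x ≤ suc x′ × x′ ≤ suc x × y ≤ suc y′ × y′ ≤ suc y

  near-sym : ∀ {x y x′ y′} → Near x y x′ y′ → Near x′ y′ x y
  near-sym (a , b , c , d) = b , a , d , c

  -- Both sides are strict, so moving from one to the other changes some coordinate by at least two.
  near-side : ∀ e {x y x′ y′} → Near x y x′ y′ → Inside e x y → ¬ Outside e x′ y′
  near-side e (x≤ , _) (s<x , _) (inj₁ x′<s) = <⇒≱ (<-≤-trans (s≤s x′<s) s<x) x≤
  near-side e (_ , _ , _ , ≤y) (_ , y<t) (inj₂ t<y′) = <⇒≱ (<-≤-trans (s≤s y<t) t<y′) ≤y

  Crosses-startˡ : ∀ {e f} → Proper e → Proper f →
    start e < start f → start f < stop e → stop e < stop f → Crosses e f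
  Crosses-startˡ {e} {f} pe pf a b c = inj₁ (interleave⇒ {e} {f} pe pf a b c)

  Crosses-startʳ : ∀ {e f} → Proper e → Proper f →
    start f < start e → start e < stop f → stop f < stop e → Crosses e f
  Crosses-startʳ {e} {f} pe pf a b c = inj₂ (interleave⇒ {f} {e} pf pe a b c)

  module _ {e g : Chord} (pe : Proper e) (pg : Proper g) {x y : ℕ} (x≤y : x ≤ y)
           (on-e : On e x y) (¬on-g : ¬ On g x y) (g≢e : g ≢ e) (¬cross : ¬ Crosses e g) where

    private
      s≤x = proj₁ on-e
      y≤t = proj₁ (proj₂ on-e)

    -- Follow `e` from the point back to its left end. The side of `g` could change only where the
    -- two drawings meet, and there the order of the clones would make `e` and `g` cross.
    agree-left : left e ≢ left g → left e ≢ right g → Agree g x y (left e)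
    agree-left l≢l l≢r with side g x y
    ... | isOn o = contradiction o ¬on-g
    ... | isInside (s′<x , y<t′) = inj₁ ((s′<x , y<t′) ,
        ≤∧≢⇒< (start≤start⇒ {g} {e} pg pe (<⇒≤ s′<s)) (λ eq → l≢l (sym eq)) ,
        ≤∧≢⇒< (start≤stop⇒ {e} {g} pe (≤-trans s≤x (≤-trans x≤y (<⇒≤ y<t′)))) l≢r)
      where
      s′<s : start g < start e
      s′<s with proj₂ (proj₂ on-e)
      ... | inj₁ x≡s = subst (start g <_) x≡s s′<x
      ... | inj₂ y≡t with <-cmp (start g) (start e)
      ...   | tri< lt _ _ = lt
      ...   | tri≈ _ eq _ = contradiction (start-injective pg pe eq) g≢e
      ...   | tri> _ _ gt = contradiction
              (Crosses-startˡ {e} {g} pe pg gt (<-≤-trans s′<x (≤-trans x≤y y≤t))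
                (subst (_< stop g) y≡t y<t′)) ¬cross
    ... | isOutside (inj₁ x<s′) = inj₂ (inj₁ x<s′ ,
        inj₁ (≤∧≢⇒< (start≤start⇒ {e} {g} pe pg (≤-trans s≤x (<⇒≤ x<s′))) l≢l))
    ... | isOutside (inj₂ t′<y) = inj₂ (inj₂ t′<y , beyond)
      where
      beyond : Beyond g (left e)
      beyond with ≤-total (start e) (start g) | <-≤-connex (start e) (stop g)
      ... | inj₁ s≤s′ | _ = inj₁ (≤∧≢⇒< (start≤start⇒ {e} {g} pe pg s≤s′) l≢l)
      ... | inj₂ s′≤s | inj₂ t′≤s = inj₂ (≤∧≢⇒< (stop≤start⇒ {g} {e} pe t′≤s) (λ eq → l≢r (sym eq)))
      ... | inj₂ s′≤s | inj₁ s<t′ = contradiction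
              (Crosses-startʳ {e} {g} pe pg
                (≤∧≢⇒< s′≤s (λ eq → g≢e (start-injective pg pe eq))) s<t′ (<-≤-trans t′<y y≤t))
              ¬cross

    agree-right : right e ≢ left g → right e ≢ right g → Agree g x y (right e)
    agree-right r≢l r≢r with side g x y
    ... | isOn o = contradiction o ¬on-g
    ... | isInside (s′<x , y<t′) = inj₁ ((s′<x , y<t′) ,
        ≤∧≢⇒< (start≤stop⇒ {g} {e} pg (≤-trans (<⇒≤ s′<x) (≤-trans x≤y y≤t))) (λ eq → r≢l (sym eq)) ,
        ≤∧≢⇒< (stop≤stop⇒ {e} {g} t≤t′) r≢r)
      where
      t≤t′ : stop e ≤ stop g
      t≤t′ with proj₂ (proj₂ on-e)
      ... | inj₂ y≡t = subst (_≤ stop g) y≡t (<⇒≤ y<t′)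
      ... | inj₁ x≡s with ≤-<-connex (stop e) (stop g)
      ...   | inj₁ le = le
      ...   | inj₂ gt = contradiction
              (Crosses-startʳ {e} {g} pe pg (subst (start g <_) x≡s s′<x)
                (≤-<-trans (≤-trans s≤x x≤y) y<t′) gt) ¬cross
    ... | isOutside (inj₂ t′<y) = inj₂ (inj₂ t′<y ,
        inj₂ (≤∧≢⇒< (stop≤stop⇒ {g} {e} (<⇒≤ (<-≤-trans t′<y y≤t))) (λ eq → r≢r (sym eq))))
    ... | isOutside (inj₁ x<s′) = inj₂ (inj₁ x<s′ , beyond)
      where
      beyond : Beyond g (right e)
      beyond with ≤-<-connex (stop e) (start g) | ≤-<-connex (stop g) (stop e)
      ... | inj₁ t≤s′ | _ = inj₁ (≤∧≢⇒< (stop≤start⇒ {e} {g} pg t≤s′) r≢l)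
      ... | inj₂ s′<t | inj₁ t′≤t = inj₂ (≤∧≢⇒< (stop≤stop⇒ {g} {e} t′≤t) (λ eq → r≢r (sym eq)))
      ... | inj₂ s′<t | inj₂ t<t′ = contradiction
              (Crosses-startˡ {e} {g} pe pg (≤-<-trans s≤x x<s′) s′<t t<t′) ¬cross

  -- Radial paths from lattice points to vertices.

  Hits : List ℕ → Chord → Set
  Hits S e = left e ∈ˡ S ⊎ right e ∈ˡ S

  module Paths (es : List Chord) (proper : ∀ {e} → e ∈ˡ es → Proper e) (k : ℕ)
    (minPlanar : ∀ {e f} → e ∈ˡ es → f ∈ˡ es → Crosses e f →
      length (filter (crosses? e) es) ≤ k ⊎ length (filter (crosses? f) es) ≤ k) where

    Light : Chord → Set
    Light e = length (filter (crosses? e) es) ≤ k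

    -- The trace of a path from `(x, y)` to `end`: chords that it may meet have an endpoint in
    -- `support`, all others have both of its ends on the same side.
    record RadialPath (x y : ℕ) : Set where
      field
        end     : ℕ
        support : List ℕ
        end∈    : end ∈ˡ support
        short   : length support ≤ ⌊ k /2⌋ + 2
        agrees  : ∀ {g} → g ∈ˡ es → Hits support g ⊎ Agree g x y end

    open RadialPath public

    trivialPath : ∀ {x y} a → (∀ {g} → g ∈ˡ es → (left g ≡ a ⊎ right g ≡ a) ⊎ Agree g x y a) →
      RadialPath x y
    trivialPath a ag = record
      { end = a ; support = a ∷ [] ; end∈ = here refl
      ; short = ≤-trans (s≤s z≤n) (m≤n+m 2 ⌊ k /2⌋)
      ; agrees = λ g∈ → [ (λ { (inj₁ eq) → inj₁ (inj₁ (here eq))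
                            ; (inj₂ eq) → inj₁ (inj₂ (here eq)) }) , inj₂ ]′ (ag g∈)
      }

    leftmost : ∀ {y} → RadialPath 0 y
    leftmost = trivialPath 0 ag
      where
      ag : ∀ {g} → g ∈ˡ es → (left g ≡ 0 ⊎ right g ≡ 0) ⊎ Agree g 0 _ 0
      ag {g} _ with m≤n⇒m<n∨m≡n (z≤n {left g})
      ... | inj₁ 0<l = inj₂ (inj₂ (inj₁ (0<start g) , inj₁ 0<l))
      ... | inj₂ 0≡l = inj₁ (inj₁ (sym 0≡l))

    -- The end `m` is artificial: it is one past the last vertex and therefore beyond every chord,
    -- as is the region from height `top` on.
    topmost : ∀ {x y} → top ≤ y → RadialPath x y
    topmost top≤y = trivialPath m λ {g} _ →
      inj₂ (inj₂ (inj₂ (<-≤-trans (stop<top g) top≤y) , inj₂ (right<m g)))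

    -- The point is a clone of `vertex x`, so the path is constant. Passing to blocks keeps each
    -- comparison with a chord strict unless `vertex x` is one of its endpoints.
    diagonal : ∀ x → RadialPath x x
    diagonal x = trivialPath (vertex x) ag
      where
      ag : ∀ {g} → g ∈ˡ es → (left g ≡ vertex x ⊎ right g ≡ vertex x) ⊎ Agree g x x (vertex x)
      ag {g} g∈ with side g x x
      ... | isOn (_ , _ , inj₁ x≡s) =
          inj₁ (inj₁ (trans (sym (vertex-start g (proper g∈))) (cong vertex (sym x≡s))))
      ... | isOn (_ , _ , inj₂ x≡t) =
          inj₁ (inj₂ (trans (sym (vertex-stop g)) (cong vertex (sym x≡t))))
      ... | isInside (s<x , x<t)
          with m≤n⇒m<n∨m≡n (subst (_≤ vertex x) (vertex-start g (proper g∈)) (vertex-mono (<⇒≤ s<x)))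
             | m≤n⇒m<n∨m≡n (subst (vertex x ≤_) (vertex-stop g) (vertex-mono (<⇒≤ x<t)))
      ...   | inj₂ l≡ | _ = inj₁ (inj₁ l≡)
      ...   | inj₁ _  | inj₂ ≡r = inj₁ (inj₂ (sym ≡r))
      ...   | inj₁ l< | inj₁ <r = inj₂ (inj₁ ((s<x , x<t) , (l< , <r)))
      ag {g} g∈ | isOutside (inj₁ x<s)
          with m≤n⇒m<n∨m≡n (subst (vertex x ≤_) (vertex-start g (proper g∈)) (vertex-mono (<⇒≤ x<s)))
      ...   | inj₁ <l = inj₂ (inj₂ (inj₁ x<s , inj₁ <l))
      ...   | inj₂ ≡l = inj₁ (inj₁ (sym ≡l))
      ag {g} g∈ | isOutside (inj₂ t<x)
          with m≤n⇒m<n∨m≡n (subst (_≤ vertex x) (vertex-stop g) (vertex-mono (<⇒≤ t<x)))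
      ...   | inj₁ r< = inj₂ (inj₂ (inj₂ t<x , inj₂ r<))
      ...   | inj₂ r≡ = inj₁ (inj₂ r≡)

    -- Prepends one lattice step. A chord avoiding the new position also avoids the old one by
    -- assumption, and `near-side` keeps both on the same side of it.
    extend : ∀ {x y x′ y′} → Near x y x′ y′ →
      (∀ {g} → g ∈ˡ es → On g x y → On g x′ y′) → RadialPath x′ y′ → RadialPath x y
    extend {x} {y} {x′} {y′} near on⇒on p = record
      { end = end p ; support = support p ; end∈ = end∈ p ; short = short p ; agrees = ag }
      where
      ag : ∀ {g} → g ∈ˡ es → Hits (support p) g ⊎ Agree g x y (end p)
      ag {g} g∈ with agrees p g∈
      ... | inj₁ hit = inj₁ hit
      ... | inj₂ (inj₁ (in′ , w)) with side g x y
      ...   | isInside i  = inj₂ (inj₁ (i , w))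
      ...   | isOutside o = contradiction o (near-side g (near-sym near) in′)
      ...   | isOn o      = contradiction (on⇒on g∈ o) (¬inside∧on g in′)
      ag {g} g∈ | inj₂ (inj₂ (out′ , b)) with side g x y
      ...   | isInside i  = contradiction out′ (near-side g near i)
      ...   | isOutside o = inj₂ (inj₂ (o , b))
      ...   | isOn o      = contradiction (on⇒on g∈ o) (¬outside∧on g out′)

    -- c is the common endpoint of the chords other than e through the point.
    module Along {e} (e∈ : e ∈ˡ es) {x y c : ℕ} (x≤y : x ≤ y) (on-e : On e x y)
      (others : ∀ {g} → g ∈ˡ es → On g x y → g ≡ e ⊎ (left g ≡ c ⊎ right g ≡ c)) where

      private
        Q? : ∀ g → Dec (Agree g x y (left e))
        Q? g = agree? g x y (left e)

        crossing = filter (crosses? e) es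

      via : ∀ a → left e ≡ a ⊎ right e ≡ a → (xs : List Chord) → length xs ≤ ⌊ k /2⌋ →
        (∀ {g} → g ∈ˡ es → left g ≢ a → right g ≢ a → g ≢ e → ¬ On g x y → ¬ (g ∈ˡ xs) → Agree g x y a) →
        RadialPath x y
      via a a∈e xs xs≤ cover = record
        { end = a ; support = S ; end∈ = here refl
        ; short = ≤-trans (s≤s (s≤s (≤-trans (≤-reflexive (length-map left xs)) xs≤)))
                    (≤-reflexive (+-comm 2 ⌊ k /2⌋))
        ; agrees = ag
        }
        where
        S : List ℕ
        -- One vertex for the end, one for the other chord through the point, and one for each chord
        -- crossed on the way: hence the bound `⌊ k /2⌋ + 2`.
        S = a ∷ c ∷ map left xs

        inS? : ∀ z → Dec (z ∈ˡ S)
        inS? z = any? (z ≟_) S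

        at-c : ∀ {g} → g ≡ e ⊎ (left g ≡ c ⊎ right g ≡ c) → Hits S g
        at-c (inj₁ refl) = [ (λ eq → inj₁ (here eq)) , (λ eq → inj₂ (here eq)) ]′ a∈e
        at-c (inj₂ (inj₁ eq)) = inj₁ (there (here eq))
        at-c (inj₂ (inj₂ eq)) = inj₂ (there (here eq))

        ag : ∀ {g} → g ∈ˡ es → Hits S g ⊎ Agree g x y a
        ag {g} g∈ with inS? (left g) | inS? (right g) | on? g x y
        ... | yes l∈ | _      | _     = inj₁ (inj₁ l∈)
        ... | no _   | yes r∈ | _     = inj₁ (inj₂ r∈)
        ... | no _   | no _   | yes o = inj₁ (at-c (others g∈ o))
        ... | no l∉  | no r∉  | no ¬o = inj₂ (cover g∈
                (λ eq → l∉ (here eq)) (λ eq → r∉ (here eq))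
                (λ { refl → ¬o on-e })
                ¬o (λ g∈xs → l∉ (there (there (∈-map⁺ left g∈xs)))))

      -- `Q?` splits the chords crossing `e` into those agreeing with the left end and the rest. The
      -- rest must be covered when going left, the agreeing ones when going right; one of the two
      -- groups has at most `⌊ k /2⌋` members.
      along : Light e → RadialPath x y
      along light with +-≤-halves (≤-trans (≤-reflexive (length-filter-split Q? crossing)) light)
      ... | inj₂ B≤ = via (left e) (inj₁ refl) _ B≤ cover
        where
        cover : ∀ {g} → g ∈ˡ es → left g ≢ left e → right g ≢ left e → g ≢ e → ¬ On g x y →
          ¬ (g ∈ˡ filter (λ h → ¬? (Q? h)) crossing) → Agree g x y (left e)
        cover {g} g∈ l≢ r≢ g≢e ¬on g∉ with crosses? e g | Q? g
        ... | _     | yes q = q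
        ... | yes c | no ¬q = contradiction (∈-filter⁺ _ (∈-filter⁺ (crosses? e) g∈ c) ¬q) g∉
        ... | no ¬c | no _  = agree-left (proper e∈) (proper g∈) x≤y on-e ¬on g≢e ¬c
                                (λ eq → l≢ (sym eq)) (λ eq → r≢ (sym eq))
      ... | inj₁ A≤ = via (right e) (inj₂ refl) _ A≤ cover
        where
        cover : ∀ {g} → g ∈ˡ es → left g ≢ right e → right g ≢ right e → g ≢ e → ¬ On g x y →
          ¬ (g ∈ˡ filter Q? crossing) → Agree g x y (right e)
        cover {g} g∈ l≢ r≢ g≢e ¬on g∉ with crosses? e g | Q? g
        ... | yes c | yes q = contradiction (∈-filter⁺ Q? (∈-filter⁺ (crosses? e) g∈ c) q) g∉
        ... | no ¬c | _     = agree-right (proper e∈) (proper g∈) x≤y on-e ¬on g≢e ¬c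
                                (λ eq → l≢ (sym eq)) (λ eq → r≢ (sym eq))
        -- The two ends of `e` lie on opposite sides of a crossing chord `g`, so disagreement with
        -- the left end is agreement with the right end.
        ... | yes (inj₁ (l<l , l<r , r<r)) | no ¬q with side g x y
        ...   | isInside i  = inj₁ (i , l<r , r<r)
        ...   | isOutside o = contradiction (inj₂ (o , inj₁ l<l)) ¬q
        ...   | isOn o      = contradiction o ¬on
        cover {g} g∈ l≢ r≢ g≢e ¬on g∉ | yes (inj₂ (l<l , l<r , r<r)) | no ¬q with side g x y
        ...   | isInside i  = contradiction (inj₁ (i , l<l , l<r)) ¬q
        ...   | isOutside o = inj₂ (o , inj₂ r<r)
        ...   | isOn o      = contradiction o ¬on

    -- Besides `e`, at most one chord passes through the point, and it runs in the other direction.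
    -- The coordinate on which it runs names one of its endpoints, which serves as `c`.
    light-path : ∀ {e} → e ∈ˡ es → ∀ {x y} → x ≤ y → On e x y → Light e → RadialPath x y
    light-path {e} e∈ {x} {y} x≤y on-e@(_ , _ , inj₁ x≡s) light =
      Along.along e∈ {c = vertex y} x≤y on-e others light
      where
      others : ∀ {g} → g ∈ˡ es → On g x y → g ≡ e ⊎ (left g ≡ vertex y ⊎ right g ≡ vertex y)
      others g∈ (_ , _ , inj₁ x≡s′) = inj₁ (start-injective (proper g∈) (proper e∈) (trans (sym x≡s′) x≡s))
      others {g} g∈ (_ , _ , inj₂ y≡t′) = inj₂ (inj₂ (trans (sym (vertex-stop g)) (cong vertex (sym y≡t′))))
    light-path {e} e∈ {x} {y} x≤y on-e@(_ , _ , inj₂ y≡t) light =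
      Along.along e∈ {c = vertex x} x≤y on-e others light
      where
      others : ∀ {g} → g ∈ˡ es → On g x y → g ≡ e ⊎ (left g ≡ vertex x ⊎ right g ≡ vertex x)
      others g∈ (_ , _ , inj₂ y≡t′) = inj₁ (stop-injective (proper g∈) (proper e∈) (trans (sym y≡t′) y≡t))
      others {g} g∈ (_ , _ , inj₁ x≡s′) =
        inj₂ (inj₁ (trans (sym (vertex-start g (proper g∈))) (cong vertex (sym x≡s′))))

    -- A point on no light chord lies on at most one chord; follow it (or, failing that,
    -- the vertical line) until a light chord or a vertex is met.
    radial : ∀ d x y → y ≡ d + x → RadialPath x y
    radial d zero y _ = leftmost
    radial zero (suc x) y refl = diagonal (suc x)
    radial (suc d) x@(suc _) y refl with top ≤? y
    ... | yes top≤y = topmost top≤y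
    ... | no _ with any? (λ e → on? e x y ×-dec (length (filter (crosses? e) es) ≤? k)) es
    ...   | yes found with find found
    ...     | e , e∈ , on-e , light = light-path e∈ (m≤n+m x (suc d)) on-e light
    radial (suc d) x@(suc _) y refl | no _ | no ¬light
        with any? (λ e → (y ≟ stop e) ×-dec (start e ≤? x)) es
    -- A step down, here, and a step right, below, both lower the height `d` above the diagonal, so
    -- the recursion ends.
    ...   | no none = extend near down (radial d x (d + x) refl)
      where
      near : Near x (suc (d + x)) x (d + x)
      near = n≤1+n x , n≤1+n x , ≤-refl , m≤n⇒m≤1+n (n≤1+n (d + x))

      down : ∀ {g} → g ∈ˡ es → On g x (suc (d + x)) → On g x (d + x)
      down g∈ (s≤x , y≤t , inj₁ x≡s) = s≤x , <⇒≤ y≤t , inj₁ x≡s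
      down g∈ (s≤x , y≤t , inj₂ y≡t) = contradiction (lose g∈ (y≡t , s≤x)) none
    ...   | yes found with find found
    ...     | e , e∈ , y≡t , s≤x = extend near step (radial d (suc x) y (sym (+-suc d x)))
      where
      near : Near x y (suc x) y
      near = m≤n⇒m≤1+n (n≤1+n x) , ≤-refl , n≤1+n y , n≤1+n y

      x<y : x < y
      x<y = s≤s (m≤n+m x d)

      step : ∀ {g} → g ∈ˡ es → On g x y → On g (suc x) y
      step g∈ (s′≤x , y≤t′ , inj₂ y≡t′) = m≤n⇒m≤1+n s′≤x , y≤t′ , inj₂ y≡t′
      step {g} g∈ on-g@(s′≤x , y≤t′ , inj₁ x≡s′) with m≤n⇒m<n∨m≡n y≤t′
      ... | inj₂ y≡t′ = m≤n⇒m≤1+n s′≤x , y≤t′ , inj₂ y≡t′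
      -- A vertical chord continuing above `y` would cross the horizontal `e`; one of the two would
      -- then be light, yet no light chord passes through the point.
      ... | inj₁ y<t′ with minPlanar e∈ g∈ (Crosses-startˡ {e} {g} (proper e∈) (proper g∈)
              (≤∧≢⇒< (≤-trans s≤x (≤-reflexive x≡s′)) s≢s′)
              (subst₂ _<_ x≡s′ y≡t x<y) (subst (_< stop g) y≡t y<t′))
        where
        s≢s′ : start e ≢ start g
        s≢s′ eq = <⇒≢ y<t′ (trans y≡t (cong stop (start-injective (proper e∈) (proper g∈) eq)))
      ...   | inj₁ light-e = contradiction (lose e∈ ((s≤x , ≤-reflexive y≡t , inj₂ y≡t) , light-e)) ¬light
      ...   | inj₂ light-g = contradiction (lose g∈ (on-g , light-g)) ¬light

-- Sperner's lemma by parity.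

data Colour : Set where
  c₀ c₁ c₂ : Colour

edge₀₁ : Colour → Colour → Bool
edge₀₁ c₀ c₁ = true
edge₀₁ c₁ c₀ = true
edge₀₁ _  _  = false

≢c₀ : Colour → Bool
≢c₀ c₀ = false
≢c₀ _  = true

-- Sperner's lemma on the triangulated quadrant: the number of c₀c₁-edges along a row,
-- mod 2, does not change from one row to the next.
module Sperner {P : Set} (_∼_ : P → P → Set) (∼-sym : ∀ {p q} → p ∼ q → q ∼ p)
  (colour : P → Colour)
  (¬rainbow : ∀ {p q r} → p ∼ q → q ∼ r → p ∼ r →
    colour p ≡ c₀ → colour q ≡ c₁ → colour r ≡ c₂ → ⊥) where

  -- Only a rainbow triangle has an odd number of `c₀c₁`-edges.
  triangle : ∀ {p q r} → p ∼ q → q ∼ r → p ∼ r →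
    edge₀₁ (colour p) (colour r) ≡ edge₀₁ (colour p) (colour q) xor edge₀₁ (colour q) (colour r)
  triangle {p} {q} {r} pq qr pr with colour p in cp | colour q in cq | colour r in cr
  ... | c₀ | c₁ | c₂ = contradiction cr (¬rainbow pq qr pr cp cq)
  ... | c₀ | c₂ | c₁ = contradiction cq (¬rainbow pr (∼-sym qr) pq cp cr)
  ... | c₁ | c₀ | c₂ = contradiction cr (¬rainbow (∼-sym pq) pr qr cq cp)
  ... | c₁ | c₂ | c₀ = contradiction cq (¬rainbow (∼-sym pr) pq (∼-sym qr) cr cp)
  ... | c₂ | c₀ | c₁ = contradiction cp (¬rainbow qr (∼-sym pr) (∼-sym pq) cq cr)
  ... | c₂ | c₁ | c₀ = contradiction cp (¬rainbow (∼-sym qr) (∼-sym pq) (∼-sym pr) cr cq)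
  ... | c₀ | c₀ | c₀ = refl
  ... | c₀ | c₀ | c₁ = refl
  ... | c₀ | c₀ | c₂ = refl
  ... | c₀ | c₁ | c₀ = refl
  ... | c₀ | c₁ | c₁ = refl
  ... | c₀ | c₂ | c₀ = refl
  ... | c₀ | c₂ | c₂ = refl
  ... | c₁ | c₀ | c₀ = refl
  ... | c₁ | c₀ | c₁ = refl
  ... | c₁ | c₁ | c₀ = refl
  ... | c₁ | c₁ | c₁ = refl
  ... | c₁ | c₁ | c₂ = refl
  ... | c₁ | c₂ | c₁ = refl
  ... | c₁ | c₂ | c₂ = refl
  ... | c₂ | c₀ | c₀ = refl
  ... | c₂ | c₀ | c₂ = refl
  ... | c₂ | c₁ | c₁ = refl
  ... | c₂ | c₁ | c₂ = refl
  ... | c₂ | c₂ | c₀ = refl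
  ... | c₂ | c₂ | c₁ = refl
  ... | c₂ | c₂ | c₂ = refl

  module _ (grid : ℕ → ℕ → P)
    (horizontal : ∀ d x → grid d x ∼ grid d (suc x))
    (vertical   : ∀ d x → grid d x ∼ grid (suc d) x)
    (diagonal   : ∀ d x → grid (suc d) x ∼ grid d (suc x)) where

    hue : ℕ → ℕ → Colour
    hue d x = colour (grid d x)

    row : ℕ → ℕ → Bool
    row d zero    = false
    row d (suc x) = row d x xor edge₀₁ (hue d x) (hue d (suc x))

    private
      regroup : ∀ r u v w → (r xor u) xor (v xor w) ≡ (r xor (u xor v)) xor w
      regroup true  true  true  w = refl
      regroup true  true  false w = refl
      regroup true  false true  true  = refl
      regroup true  false true  false = refl
      regroup true  false false w = refl
      regroup false true  true  true  = refl
      regroup false true  true  false = refl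
      regroup false true  false w = refl
      regroup false false v     w = refl

    -- Induction on `x`: a unit square consists of two triangles sharing the diagonal, whose
    -- contribution cancels. The left column, all `c₀`, starts the induction.
    row-suc : (∀ d → hue d 0 ≡ c₀) →
      ∀ d x → row (suc d) x ≡ row d x xor edge₀₁ (hue d x) (hue (suc d) x)
    row-suc left d zero = sym (cong₂ edge₀₁ (left d) (left (suc d)))
    row-suc left d (suc x) = begin
      row (suc d) x xor edge₀₁ a′ b′
        ≡⟨ cong₂ _xor_ (row-suc left d x)
             (triangle (diagonal d x) (vertical d (suc x)) (horizontal (suc d) x)) ⟩
      (row d x xor edge₀₁ a a′) xor (edge₀₁ a′ b xor edge₀₁ b b′)
        ≡⟨ regroup (row d x) (edge₀₁ a a′) (edge₀₁ a′ b) (edge₀₁ b b′) ⟩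
      (row d x xor (edge₀₁ a a′ xor edge₀₁ a′ b)) xor edge₀₁ b b′
        ≡⟨ cong (λ z → (row d x xor z) xor edge₀₁ b b′)
             (triangle (vertical d x) (diagonal d x) (horizontal d x)) ⟨
      (row d x xor edge₀₁ a b) xor edge₀₁ b b′ ∎
      where
      open ≡-Reasoning
      a  = hue d x
      b  = hue d (suc x)
      a′ = hue (suc d) x
      b′ = hue (suc d) (suc x)

    -- The top row has no `c₀c₁`-edge. The bottom row goes from `c₀` to `c₂` and enters or leaves
    -- `c₀` only through `c₁`, so its number of such edges is odd. The right column, all `c₂`, makes
    -- the two parities equal.
    sperner : (N : ℕ) →
      (∀ d → hue d 0 ≡ c₀) →
      (∀ d → hue d N ≡ c₂) →
      (∀ x → hue N (suc x) ≡ c₂) →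
      (∀ x → hue 0 x ≡ c₀ → hue 0 (suc x) ≢ c₂) →
      (∀ x → hue 0 x ≡ c₂ → hue 0 (suc x) ≢ c₀) →
      ⊥
    sperner N left right top up down with
      trans (sym (top-row N)) (trans (constant N) (trans (bottom-row N) (cong ≢c₀ (right 0))))
      where
      constant : ∀ d → row d N ≡ row 0 N
      constant zero    = refl
      constant (suc d) = begin
        row (suc d) N                                       ≡⟨ row-suc left d N ⟩
        row d N xor edge₀₁ (hue d N) (hue (suc d) N)
          ≡⟨ cong (row d N xor_) (cong₂ edge₀₁ (right d) (right (suc d))) ⟩
        row d N xor false                                   ≡⟨ xor-identityʳ (row d N) ⟩
        row d N                                             ≡⟨ constant d ⟩
        row 0 N                                             ∎
        where open ≡-Reasoning

      top-row : ∀ x → row N x ≡ false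
      top-row zero          = refl
      top-row (suc zero)    = cong₂ edge₀₁ (left N) (top 0)
      top-row (suc (suc x)) = cong₂ _xor_ (top-row (suc x)) (cong₂ edge₀₁ (top x) (top (suc x)))

      bottom-row : ∀ x → row 0 x ≡ ≢c₀ (hue 0 x)
      bottom-row zero = sym (cong ≢c₀ (left 0))
      bottom-row (suc x) = trans (cong (_xor edge₀₁ (hue 0 x) (hue 0 (suc x))) (bottom-row x))
        (step (hue 0 x) (hue 0 (suc x)) (up x) (down x))
        where
        step : ∀ a b → (a ≡ c₀ → b ≢ c₂) → (a ≡ c₂ → b ≢ c₀) → ≢c₀ a xor edge₀₁ a b ≡ ≢c₀ b
        step c₀ c₀ _ _ = refl
        step c₀ c₁ _ _ = refl
        step c₀ c₂ u _ = contradiction refl (u refl)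
        step c₁ c₀ _ _ = refl
        step c₁ c₁ _ _ = refl
        step c₁ c₂ _ _ = refl
        step c₂ c₀ _ d = contradiction refl (d refl)
        step c₂ c₁ _ _ = refl
        step c₂ c₂ _ _ = refl
    ... | ()

-- Cardinalities of subsets, and colouring by thirds of the weight.

∣p∪q∣≤∣p∣+∣q∣ : ∀ {n} (p q : Subset n) → ∣ p ∪ q ∣ ≤ ∣ p ∣ + ∣ q ∣
∣p∪q∣≤∣p∣+∣q∣ [] [] = z≤n
∣p∪q∣≤∣p∣+∣q∣ (outside ∷ p) (outside ∷ q) = ∣p∪q∣≤∣p∣+∣q∣ p q
∣p∪q∣≤∣p∣+∣q∣ (outside ∷ p) (inside ∷ q) =
  ≤-trans (s≤s (∣p∪q∣≤∣p∣+∣q∣ p q)) (≤-reflexive (sym (+-suc ∣ p ∣ ∣ q ∣)))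
∣p∪q∣≤∣p∣+∣q∣ (inside ∷ p) (outside ∷ q) = s≤s (∣p∪q∣≤∣p∣+∣q∣ p q)
∣p∪q∣≤∣p∣+∣q∣ (inside ∷ p) (inside ∷ q) =
  s≤s (≤-trans (∣p∪q∣≤∣p∣+∣q∣ p q) (+-monoʳ-≤ ∣ p ∣ (n≤1+n ∣ q ∣)))

x∈p─q⇒x∉q : ∀ {n} {p q : Subset n} {x} → x ∈ p ─ q → x ∉ q
x∈p─q⇒x∉q {p = _ ∷ _} {outside ∷ _} here ()
x∈p─q⇒x∉q {p = _ ∷ _} {outside ∷ _} (there x∈) (there x∈q) = x∈p─q⇒x∉q x∈ x∈q
x∈p─q⇒x∉q {p = _ ∷ _} {inside ∷ _} (there x∈) (there x∈q) = x∈p─q⇒x∉q x∈ x∈q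

∣p─q∣+∣p∩q∣≡∣p∣ : ∀ {n} (p q : Subset n) → ∣ p ─ q ∣ + ∣ p ∩ q ∣ ≡ ∣ p ∣
∣p─q∣+∣p∩q∣≡∣p∣ [] [] = refl
∣p─q∣+∣p∩q∣≡∣p∣ (outside ∷ p) (outside ∷ q) = ∣p─q∣+∣p∩q∣≡∣p∣ p q
∣p─q∣+∣p∩q∣≡∣p∣ (outside ∷ p) (inside ∷ q) = ∣p─q∣+∣p∩q∣≡∣p∣ p q
∣p─q∣+∣p∩q∣≡∣p∣ (inside ∷ p) (outside ∷ q) = cong suc (∣p─q∣+∣p∩q∣≡∣p∣ p q)
∣p─q∣+∣p∩q∣≡∣p∣ (inside ∷ p) (inside ∷ q) = trans (+-suc _ _) (cong suc (∣p─q∣+∣p∩q∣≡∣p∣ p q))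

-- The cuts are at one third and two thirds of the total weight `W`, multiplied by 3 to avoid
-- division.
colourOf : ℕ → ℕ → Colour
colourOf W u with 3 * u <? W | 3 * u <? 2 * W
... | yes _ | _     = c₀
... | no _  | yes _ = c₁
... | no _  | no _  = c₂

colourOf≡c₀⇒ : ∀ W u → colourOf W u ≡ c₀ → 3 * u < W
colourOf≡c₀⇒ W u eq with 3 * u <? W | 3 * u <? 2 * W
... | yes p | _ = p
colourOf≡c₀⇒ W u () | no _ | yes _
colourOf≡c₀⇒ W u () | no _ | no _

colourOf≡c₁⇒ : ∀ W u → colourOf W u ≡ c₁ → W ≤ 3 * u × 3 * u < 2 * W
colourOf≡c₁⇒ W u eq with 3 * u <? W | 3 * u <? 2 * W
... | no p | yes q = ≮⇒≥ p , q
colourOf≡c₁⇒ W u () | yes _ | _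
colourOf≡c₁⇒ W u () | no _ | no _

colourOf≡c₂⇒ : ∀ W u → colourOf W u ≡ c₂ → 2 * W ≤ 3 * u
colourOf≡c₂⇒ W u eq with 3 * u <? W | 3 * u <? 2 * W
... | no _ | no p = ≮⇒≥ p
colourOf≡c₂⇒ W u () | yes _ | _
colourOf≡c₂⇒ W u () | no _ | yes _

⇒colourOf≡c₀ : ∀ W u → 3 * u < W → colourOf W u ≡ c₀
⇒colourOf≡c₀ W u p with 3 * u <? W | 3 * u <? 2 * W
... | yes _ | _ = refl
... | no ¬p | _ = contradiction p ¬p

⇒colourOf≡c₂ : ∀ W u → 2 * W ≤ 3 * u → colourOf W u ≡ c₂
⇒colourOf≡c₂ W u p with 3 * u <? W | 3 * u <? 2 * W
... | yes q | _     = contradiction (≤-trans (m≤n*m W 2) p) (<⇒≱ q)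
... | no _  | yes q = contradiction p (<⇒≱ q)
... | no _  | no _  = refl

-- Separations cut off by two positions on the circle.

module Separators {n} {G H : Graph n} (V⊆ : V H ⊆ V G)
  (Adj⊆ : ∀ {x y} → Adj H x y → Adj G x y) (D : ConvexDrawing G) where

  open ConvexDrawing D
  open Chords ∣ V G ∣

  private
    m = ∣ V G ∣
    W = ∣ V H ∣

  -- The default `∅` accommodates the artificial end `m`.
  vertexSet : ℕ → Subset n
  vertexSet i with i <? m
  ... | yes i<m = ⁅ vertexAt (fromℕ< i<m) ⁆
  ... | no _    = ∅

  ∈-vertexSet⁺ : ∀ j → vertexAt j ∈ vertexSet (toℕ j)
  ∈-vertexSet⁺ j with toℕ j <? m
  ... | yes j<m = subst (λ i → vertexAt j ∈ ⁅ vertexAt i ⁆) (sym (fromℕ<-toℕ j j<m)) (x∈⁅x⁆ _)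
  ... | no j≮m  = contradiction (toℕ<n j) j≮m

  ∈-vertexSet⁻ : ∀ i {j} → vertexAt j ∈ vertexSet i → toℕ j ≡ i
  ∈-vertexSet⁻ i {j} j∈ with i <? m
  ... | yes i<m = trans (cong toℕ (injective (x∈⁅y⁆⇒x≡y _ j∈))) (toℕ-fromℕ< i<m)
  ... | no _    = contradiction j∈ ∉∅

  ∣vertexSet∣≤1 : ∀ i → ∣ vertexSet i ∣ ≤ 1
  ∣vertexSet∣≤1 i with i <? m
  ... | yes i<m = ≤-reflexive (∣⁅x⁆∣≡1 (vertexAt (fromℕ< i<m)))
  ... | no _    = ≤-trans (≤-reflexive (∣⊥∣≡0 n)) z≤n

  prefix : ℕ → Subset n
  prefix zero    = ∅
  prefix (suc i) = prefix i ∪ vertexSet i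

  ∈-prefix⁺ : ∀ {i j} → toℕ j < i → vertexAt j ∈ prefix i
  ∈-prefix⁺ {suc i} {j} j<1+i with m<1+n⇒m<n∨m≡n j<1+i
  ... | inj₁ j<i  = x∈p∪q⁺ (inj₁ (∈-prefix⁺ j<i))
  ... | inj₂ refl = x∈p∪q⁺ (inj₂ (∈-vertexSet⁺ j))

  ∈-prefix⁻ : ∀ i {j} → vertexAt j ∈ prefix i → toℕ j < i
  ∈-prefix⁻ zero j∈ = contradiction j∈ ∉∅
  ∈-prefix⁻ (suc i) j∈ with x∈p∪q⁻ (prefix i) (vertexSet i) j∈
  ... | inj₁ j∈′ = m<n⇒m<1+n (∈-prefix⁻ i j∈′)
  ... | inj₂ j∈′ = s≤s (≤-reflexive (∈-vertexSet⁻ i j∈′))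

  -- Positions come from the drawing of `G`, but only vertices of the subgraph `H` are counted,
  -- since it is `H` that has to be balanced.
  weight : ℕ → ℕ
  weight i = ∣ V H ∩ prefix i ∣

  position : ∀ {x} → x ∈ V H → ∃[ j ] vertexAt j ≡ x
  position x∈ = exhaustive (V⊆ x∈)

  weight-mono : ∀ {i j} → i ≤ j → weight i ≤ weight j
  weight-mono {i} {j} i≤j = p⊆q⇒∣p∣≤∣q∣ sub
    where
    sub : V H ∩ prefix i ⊆ V H ∩ prefix j
    sub x∈ with x∈p∩q⁻ _ _ x∈
    ... | x∈H , x∈i with position x∈H
    ...   | l , refl = x∈p∩q⁺ (x∈H , ∈-prefix⁺ (<-≤-trans (∈-prefix⁻ i x∈i) i≤j))

  weight-suc : ∀ i → weight (suc i) ≤ suc (weight i)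
  weight-suc i = begin
    weight (suc i)                      ≤⟨ p⊆q⇒∣p∣≤∣q∣ sub ⟩
    ∣ (V H ∩ prefix i) ∪ vertexSet i ∣  ≤⟨ ∣p∪q∣≤∣p∣+∣q∣ (V H ∩ prefix i) _ ⟩
    weight i + ∣ vertexSet i ∣          ≤⟨ +-monoʳ-≤ (weight i) (∣vertexSet∣≤1 i) ⟩
    weight i + 1                        ≡⟨ +-comm (weight i) 1 ⟩
    suc (weight i)                      ∎
    where
    open ≤-Reasoning
    sub : V H ∩ prefix (suc i) ⊆ (V H ∩ prefix i) ∪ vertexSet i
    sub x∈ with x∈p∩q⁻ (V H) _ x∈
    ... | x∈H , x∈′ with x∈p∪q⁻ (prefix i) _ x∈′
    ...   | inj₁ x∈i = x∈p∪q⁺ (inj₁ (x∈p∩q⁺ (x∈H , x∈i)))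
    ...   | inj₂ x∈v = x∈p∪q⁺ (inj₂ x∈v)

  weight-0 : weight 0 ≡ 0
  weight-0 = n≤0⇒n≡0 (≤-trans (∣p∩q∣≤∣q∣ (V H) ∅) (≤-reflexive (∣⊥∣≡0 n)))

  weight≤ : ∀ i → weight i ≤ W
  weight≤ i = p⊆q⇒∣p∣≤∣q∣ (p∩q⊆p (V H) (prefix i))

  weight-m : W ≤ weight m
  weight-m = p⊆q⇒∣p∣≤∣q∣ λ x∈ → x∈p∩q⁺ (x∈ , all x∈)
    where
    all : ∀ {x} → x ∈ V H → x ∈ prefix m
    all x∈ with position x∈
    ... | j , refl = ∈-prefix⁺ (toℕ<n j)

  vertices : List ℕ → Subset n
  vertices S = ⋃ (map vertexSet S)

  ∈-vertices : ∀ {j S} → toℕ j ∈ˡ S → vertexAt j ∈ vertices S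
  ∈-vertices {j} (here refl) = x∈p∪q⁺ (inj₁ (∈-vertexSet⁺ j))
  ∈-vertices (there j∈) = x∈p∪q⁺ (inj₂ (∈-vertices j∈))

  ∣vertices∣≤length : ∀ S → ∣ vertices S ∣ ≤ length S
  ∣vertices∣≤length [] = ≤-reflexive (∣⊥∣≡0 n)
  ∣vertices∣≤length (i ∷ S) = ≤-trans (∣p∪q∣≤∣p∣+∣q∣ (vertexSet i) _)
    (+-mono-≤ (∣vertexSet∣≤1 i) (∣vertices∣≤length S))

  -- The separator S cuts the open arc from a to b off the complementary one.
  module _ {a b : ℕ} {S : List ℕ} (a<b : a < b) (a∈S : a ∈ˡ S) (b∈S : b ∈ˡ S)
    (linked : ∀ {g} → g ∈ˡ edges D →
      Hits S g ⊎ (Within g a × Within g b) ⊎ (Beyond g a × Beyond g b))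
    (arc-small  : 3 * weight b ≤ 2 * W + 3 * weight (suc a))
    (rest-small : 3 * weight a + W ≤ 3 * weight (suc b)) where

    private
      -- `X` is the open arc and `Y` the outside of the closed arc; the vertices at `a` and `b` are
      -- left to `Z`. Thus `arc-small` bounds `X` by two thirds, and `rest-small` bounds `Y` by
      -- asking a third of the weight from the closed arc.
      X Y Z : Subset n
      X = (V H ∩ prefix b) ─ prefix (suc a)
      Y = (V H ∩ prefix a) ∪ (V H ─ prefix (suc b))
      Z = V H ∩ vertices S

      X⊆VH : X ⊆ V H
      X⊆VH x∈ = p∩q⊆p (V H) _ (p─q⊆p _ (prefix (suc a)) x∈)

      Y⊆VH : Y ⊆ V H
      Y⊆VH x∈ = [ p∩q⊆p (V H) _ , p─q⊆p (V H) _ ]′ (x∈p∪q⁻ (V H ∩ prefix a) _ x∈)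

      Z⊆VH : Z ⊆ V H
      Z⊆VH = p∩q⊆p (V H) _

      X⁻ : ∀ {j} → vertexAt j ∈ X → a < toℕ j × toℕ j < b
      X⁻ j∈ = ≮⇒≥ (λ j< → x∈p─q⇒x∉q j∈ (∈-prefix⁺ j<))
            , ∈-prefix⁻ b (p∩q⊆q (V H) _ (p─q⊆p _ (prefix (suc a)) j∈))

      Y⁻ : ∀ {j} → vertexAt j ∈ Y → toℕ j < a ⊎ b < toℕ j
      Y⁻ j∈ with x∈p∪q⁻ (V H ∩ prefix a) _ j∈
      ... | inj₁ j∈a = inj₁ (∈-prefix⁻ a (p∩q⊆q (V H) _ j∈a))
      ... | inj₂ j∉b = inj₂ (≮⇒≥ (λ j< → x∈p─q⇒x∉q j∉b (∈-prefix⁺ j<)))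

      X∪Z─Y∪Z⊆X : (X ∪ Z) ─ (Y ∪ Z) ⊆ X
      X∪Z─Y∪Z⊆X x∈ with x∈p∪q⁻ X Z (p─q⊆p _ (Y ∪ Z) x∈)
      ... | inj₁ x∈X = x∈X
      ... | inj₂ x∈Z = contradiction (q⊆p∪q Y Z x∈Z) (x∈p─q⇒x∉q x∈)

      Y∪Z─X∪Z⊆Y : (Y ∪ Z) ─ (X ∪ Z) ⊆ Y
      Y∪Z─X∪Z⊆Y x∈ with x∈p∪q⁻ Y Z (p─q⊆p _ (X ∪ Z) x∈)
      ... | inj₁ x∈Y = x∈Y
      ... | inj₂ x∈Z = contradiction (q⊆p∪q X Z x∈Z) (x∈p─q⇒x∉q x∈)

      place : ∀ j → vertexAt j ∈ V H → vertexAt j ∈ X ⊎ vertexAt j ∈ Y ⊎ vertexAt j ∈ Z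
      place j x∈ with <-cmp (toℕ j) a | <-cmp (toℕ j) b
      ... | tri≈ _ refl _ | _ = inj₂ (inj₂ (x∈p∩q⁺ (x∈ , ∈-vertices a∈S)))
      ... | _ | tri≈ _ refl _ = inj₂ (inj₂ (x∈p∩q⁺ (x∈ , ∈-vertices b∈S)))
      ... | tri< j<a _ _ | _ = inj₂ (inj₁ (x∈p∪q⁺ (inj₁ (x∈p∩q⁺ (x∈ , ∈-prefix⁺ j<a)))))
      ... | tri> _ _ _ | tri> _ _ b<j = inj₂ (inj₁ (x∈p∪q⁺ (inj₂
              (x∈p∧x∉q⇒x∈p─q x∈ (λ x∈b → <⇒≱ (∈-prefix⁻ (suc b) x∈b) b<j)))))
      ... | tri> _ _ a<j | tri< j<b _ _ = inj₁
              (x∈p∧x∉q⇒x∈p─q (x∈p∩q⁺ (x∈ , ∈-prefix⁺ j<b))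
                (λ x∈a → <⇒≱ (∈-prefix⁻ (suc a) x∈a) a<j))

      covers : (X ∪ Z) ∪ (Y ∪ Z) ≡ V H
      covers = ⊆-antisym ⊆VH VH⊆
        where
        ⊆VH : (X ∪ Z) ∪ (Y ∪ Z) ⊆ V H
        ⊆VH x∈ = [ (λ x∈A → [ X⊆VH , Z⊆VH ]′ (x∈p∪q⁻ X Z x∈A))
                 , (λ x∈B → [ Y⊆VH , Z⊆VH ]′ (x∈p∪q⁻ Y Z x∈B)) ]′ (x∈p∪q⁻ (X ∪ Z) _ x∈)

        VH⊆ : V H ⊆ (X ∪ Z) ∪ (Y ∪ Z)
        VH⊆ x∈ with position x∈
        ... | j , refl with place j x∈
        ...   | inj₁ x∈X        = p⊆p∪q _ (p⊆p∪q Z x∈X)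
        ...   | inj₂ (inj₁ x∈Y) = q⊆p∪q (X ∪ Z) _ (p⊆p∪q Z x∈Y)
        ...   | inj₂ (inj₂ x∈Z) = p⊆p∪q _ (q⊆p∪q X Z x∈Z)

      edge∈ : ∀ {i j} → toℕ i < toℕ j → Adj G (vertexAt i) (vertexAt j) → (i , j) ∈ˡ edges D
      edge∈ {i} {j} i<j adj =
        ∈-filter⁺ (isEdge? D) (∈-cartesianProduct⁺ (∈-allFin i) (∈-allFin j)) (i<j , adj)

      -- A chord from the open arc to the outside has exactly one of `a` and `b` strictly between
      -- its ends. So `linked` puts one of its ends into `S`, hence into both parts of the
      -- separation.
      separates : ∀ {x y} → x ∈ (X ∪ Z) ─ (Y ∪ Z) → y ∈ (Y ∪ Z) ─ (X ∪ Z) → ¬ Adj H x y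
      separates {x} {y} x∈ y∈ adj
        with position (X⊆VH (X∪Z─Y∪Z⊆X x∈)) | position (Y⊆VH (Y∪Z─X∪Z⊆Y y∈))
      ... | i , refl | j , refl = impossible (<-cmp (toℕ i) (toℕ j))
        where
        i∉S : ¬ (toℕ i ∈ˡ S)
        i∉S i∈ = x∈p─q⇒x∉q x∈ (q⊆p∪q Y Z (x∈p∩q⁺ (X⊆VH (X∪Z─Y∪Z⊆X x∈) , ∈-vertices i∈)))

        j∉S : ¬ (toℕ j ∈ˡ S)
        j∉S j∈ = x∈p─q⇒x∉q y∈ (q⊆p∪q X Z (x∈p∩q⁺ (Y⊆VH (Y∪Z─X∪Z⊆Y y∈) , ∈-vertices j∈)))

        a<i = proj₁ (X⁻ (X∪Z─Y∪Z⊆X x∈))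
        i<b = proj₂ (X⁻ (X∪Z─Y∪Z⊆X x∈))

        j<a⊎b<j = Y⁻ (Y∪Z─X∪Z⊆Y y∈)

        impossible : ¬ Tri (toℕ i < toℕ j) (toℕ i ≡ toℕ j) (toℕ j < toℕ i)
        impossible (tri≈ _ i≡j _) with refl ← toℕ-injective i≡j = irrefl H adj
        impossible (tri< i<j _ _) with linked (edge∈ i<j (Adj⊆ adj))
        ... | inj₁ (inj₁ i∈)                = i∉S i∈
        ... | inj₁ (inj₂ j∈)                = j∉S j∈
        ... | inj₂ (inj₁ ((i<a , _) , _))   = <-asym i<a a<i
        ... | inj₂ (inj₂ (_ , inj₁ b<i))    = <-asym b<i i<b
        ... | inj₂ (inj₂ (_ , inj₂ j<b))    =
          [ (λ j<a → <-asym i<j (<-trans j<a a<i)) , <-asym j<b ]′ j<a⊎b<j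
        impossible (tri> _ _ j<i) with linked (edge∈ j<i (symm G (Adj⊆ adj)))
        ... | inj₁ (inj₁ j∈)                = j∉S j∈
        ... | inj₁ (inj₂ i∈)                = i∉S i∈
        ... | inj₂ (inj₁ (_ , (_ , b<i)))   = <-asym b<i i<b
        ... | inj₂ (inj₂ (inj₂ i<a , _))    = <-asym i<a a<i
        ... | inj₂ (inj₂ (inj₁ a<j , _))    =
          [ <-asym a<j , (λ b<j → <-asym j<i (<-trans i<b b<j)) ]′ j<a⊎b<j

    separator : ∀ {s} → length S ≤ s → HasBalancedSeparation H s
    separator {s} S≤s = X ∪ Z , Y ∪ Z , mkSeparation covers separates , (arc , rest) ,
      ≤-trans (p⊆q⇒∣p∣≤∣q∣ ∩⊆) (≤-trans (∣vertices∣≤length S) S≤s)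
      where
      open ≤-Reasoning
      open +-*-Solver using (solve; con; _:+_; _:*_; _:=_)

      ∩⊆ : (X ∪ Z) ∩ (Y ∪ Z) ⊆ vertices S
      ∩⊆ x∈ with x∈p∩q⁻ (X ∪ Z) _ x∈
      ... | x∈A , x∈B with x∈p∪q⁻ X Z x∈A | x∈p∪q⁻ Y Z x∈B
      ...   | inj₂ x∈Z | _        = p∩q⊆q (V H) _ x∈Z
      ...   | inj₁ _   | inj₂ x∈Z = p∩q⊆q (V H) _ x∈Z
      ...   | inj₁ x∈X | inj₁ x∈Y with position (X⊆VH x∈X)
      ...     | j , refl = contradiction (Y⁻ x∈Y)
                [ <-asym (proj₁ (X⁻ x∈X)) , <-asym (proj₂ (X⁻ x∈X)) ]′

      X-size : ∣ X ∣ + weight (suc a) ≤ weight b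
      X-size = ≤-trans (+-monoʳ-≤ ∣ X ∣ (p⊆q⇒∣p∣≤∣q∣ sub))
        (≤-reflexive (∣p─q∣+∣p∩q∣≡∣p∣ (V H ∩ prefix b) (prefix (suc a))))
        where
        sub : V H ∩ prefix (suc a) ⊆ (V H ∩ prefix b) ∩ prefix (suc a)
        sub x∈ with x∈p∩q⁻ (V H) _ x∈
        ... | x∈H , x∈a with position x∈H
        ...   | j , refl = x∈p∩q⁺
                (x∈p∩q⁺ (x∈H , ∈-prefix⁺ (<-≤-trans (∈-prefix⁻ (suc a) x∈a) a<b)) , x∈a)

      arc : 3 * ∣ (X ∪ Z) ─ (Y ∪ Z) ∣ ≤ 2 * W
      arc = +-cancelʳ-≤ (3 * weight (suc a)) _ _ (begin
        3 * ∣ (X ∪ Z) ─ (Y ∪ Z) ∣ + 3 * weight (suc a)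
          ≤⟨ +-monoˡ-≤ _ (*-monoʳ-≤ 3 (p⊆q⇒∣p∣≤∣q∣ X∪Z─Y∪Z⊆X)) ⟩
        3 * ∣ X ∣ + 3 * weight (suc a)
          ≡⟨ *-distribˡ-+ 3 ∣ X ∣ _ ⟨
        3 * (∣ X ∣ + weight (suc a))
          ≤⟨ *-monoʳ-≤ 3 X-size ⟩
        3 * weight b
          ≤⟨ arc-small ⟩
        2 * W + 3 * weight (suc a) ∎)

      rest : 3 * ∣ (Y ∪ Z) ─ (X ∪ Z) ∣ ≤ 2 * W
      rest = +-cancelʳ-≤ (W + 3 * weight (suc b)) _ _ (begin
        3 * ∣ (Y ∪ Z) ─ (X ∪ Z) ∣ + (W + 3 * weight (suc b))
          ≤⟨ +-monoˡ-≤ _ (*-monoʳ-≤ 3 (≤-trans (p⊆q⇒∣p∣≤∣q∣ Y∪Z─X∪Z⊆Y)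
               (∣p∪q∣≤∣p∣+∣q∣ (V H ∩ prefix a) _))) ⟩
        3 * (weight a + Y₂) + (W + 3 * weight (suc b))
          ≡⟨ solve 4 (λ u y v z → con 3 :* (u :+ y) :+ (v :+ con 3 :* z)
                               := (con 3 :* u :+ v) :+ con 3 :* (y :+ z))
                refl (weight a) Y₂ W (weight (suc b)) ⟩
        (3 * weight a + W) + 3 * (Y₂ + weight (suc b))
          ≤⟨ +-monoˡ-≤ _ rest-small ⟩
        3 * weight (suc b) + 3 * (Y₂ + weight (suc b))
          ≡⟨ cong (λ v → 3 * weight (suc b) + 3 * v) (∣p─q∣+∣p∩q∣≡∣p∣ (V H) (prefix (suc b))) ⟩
        3 * weight (suc b) + 3 * W
          ≡⟨ solve 2 (λ v z → con 3 :* z :+ con 3 :* v := con 2 :* v :+ (v :+ con 3 :* z))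
               refl W (weight (suc b)) ⟩
        2 * W + (W + 3 * weight (suc b)) ∎)
        where
        Y₂ = ∣ V H ─ prefix (suc b) ∣

  -- Balanced separations from rainbow triangles.

  module _ (k : ℕ) (minPlanar : IsMinPlanar D k) where

    private
      isEdge : ∀ {e} → e ∈ˡ edges D → IsEdge D e
      isEdge e∈ = proj₂ (∈-filter⁻ (isEdge? D) {xs = cartesianProduct (allFin _) (allFin _)} e∈)

    open Paths (edges D) (λ e∈ → proj₁ (isEdge e∈)) k
      (λ {e} {f} e∈ f∈ → minPlanar e f (isEdge e∈) (isEdge f∈))

    private
      hueAt : ℕ → Colour
      hueAt a = colourOf W (weight a)

      bound : ℕ
      bound = 2 * ⌊ k /2⌋ + 4

    -- A chord hit by neither support agrees with both paths, and by `near-side` the two starting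
    -- points are on the same side of it; hence so are the two ends.
    pairSeparator : ∀ {x y x′ y′} (p : RadialPath x y) (q : RadialPath x′ y′) → Near x y x′ y′ → end p < end q →
      3 * weight (end q) ≤ 2 * W + 3 * weight (suc (end p)) →
      3 * weight (end p) + W ≤ 3 * weight (suc (end q)) →
      HasBalancedSeparation H bound
    pairSeparator p q p∼q a<b arc rest =
      separator {S = S} a<b (∈-++⁺ˡ (end∈ p)) (∈-++⁺ʳ _ (end∈ q)) linked arc rest
        (begin
          length S                                 ≡⟨ length-++ (support p) ⟩
          length (support p) + length (support q)  ≤⟨ +-mono-≤ (short p) (short q) ⟩
          (⌊ k /2⌋ + 2) + (⌊ k /2⌋ + 2)
            ≡⟨ solve 1 (λ h → (h :+ con 2) :+ (h :+ con 2) := con 2 :* h :+ con 4) refl ⌊ k /2⌋ ⟩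
          bound                                    ∎)
      where
      open ≤-Reasoning
      open +-*-Solver using (solve; con; _:+_; _:*_; _:=_)
      S : List ℕ
      S = support p ++ support q

      linked : ∀ {g} → g ∈ˡ edges D → Hits S g ⊎
        (Within g (end p) × Within g (end q)) ⊎ (Beyond g (end p) × Beyond g (end q))
      linked {g} g∈ with agrees p g∈ | agrees q g∈
      ... | inj₁ (inj₁ l∈) | _ = inj₁ (inj₁ (∈-++⁺ˡ l∈))
      ... | inj₁ (inj₂ r∈) | _ = inj₁ (inj₂ (∈-++⁺ˡ r∈))
      ... | inj₂ _ | inj₁ (inj₁ l∈) = inj₁ (inj₁ (∈-++⁺ʳ _ l∈))
      ... | inj₂ _ | inj₁ (inj₂ r∈) = inj₁ (inj₂ (∈-++⁺ʳ _ r∈))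
      ... | inj₂ (inj₁ (_ , wp)) | inj₂ (inj₁ (_ , wq)) = inj₂ (inj₁ (wp , wq))
      ... | inj₂ (inj₂ (_ , bp)) | inj₂ (inj₂ (_ , bq)) = inj₂ (inj₂ (bp , bq))
      ... | inj₂ (inj₁ (ip , _)) | inj₂ (inj₂ (oq , _)) = contradiction oq (near-side g p∼q ip)
      ... | inj₂ (inj₂ (op , _)) | inj₂ (inj₁ (iq , _)) =
              contradiction op (near-side g (near-sym p∼q) iq)

    weight-cancel-< : ∀ {a b} → weight a < weight b → a < b
    weight-cancel-< w< = ≰⇒> (λ b≤a → <⇒≱ w< (weight-mono b≤a))

    -- If the closed arc between the first two ends carries a third of the weight, that pair is
    -- balanced; likewise for the last two. If both arcs are lighter, the arc from first to last
    -- weighs less than two thirds, and the colours of its ends give it at least a third.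
    rainbowSeparator : ∀ {x y x′ y′ x″ y″}
      (p : RadialPath x y) (q : RadialPath x′ y′) (r : RadialPath x″ y″) →
      Near x y x′ y′ → Near x′ y′ x″ y″ → Near x y x″ y″ →
      hueAt (end p) ≡ c₀ → hueAt (end q) ≡ c₁ → hueAt (end r) ≡ c₂ →
      HasBalancedSeparation H bound
    rainbowSeparator p q r pq qr pr hp hq hr
      with colourOf≡c₀⇒ W (weight (end p)) hp | colourOf≡c₁⇒ W (weight (end q)) hq
         | colourOf≡c₂⇒ W (weight (end r)) hr
    ... | a<W | W≤b , b<2W | 2W≤c
        with 3 * weight (end p) + W ≤? 3 * weight (suc (end q))
           | 3 * weight (end q) + W ≤? 3 * weight (suc (end r))
    ...   | yes rest | _ = pairSeparator p q pq
            (weight-cancel-< (*-cancelˡ-< 3 _ _ (<-≤-trans a<W W≤b)))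
            (≤-trans (<⇒≤ b<2W) (m≤m+n _ _)) rest
    ...   | no _ | yes rest = pairSeparator q r qr
            (weight-cancel-< (*-cancelˡ-< 3 _ _ (<-≤-trans b<2W 2W≤c)))
            (begin
              3 * weight (end r)           ≤⟨ *-monoʳ-≤ 3 (weight≤ (end r)) ⟩
              3 * W                         ≡⟨ +-comm W (2 * W) ⟩
              2 * W + W                     ≤⟨ +-monoʳ-≤ (2 * W) W≤b ⟩
              2 * W + 3 * weight (end q)   ≤⟨ +-monoʳ-≤ (2 * W) (*-monoʳ-≤ 3 (weight-mono (n≤1+n (end q)))) ⟩
              2 * W + 3 * weight (suc (end q)) ∎)
            rest
      where open ≤-Reasoning
    ...   | no ¬pq | no ¬qr = pairSeparator p r pr
            (weight-cancel-< (*-cancelˡ-< 3 _ _ (<-≤-trans a<W (≤-trans W≤b (<⇒≤ (<-≤-trans b<2W 2W≤c))))))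
            (begin
              3 * weight (end r)             ≤⟨ *-monoʳ-≤ 3 (weight-mono (n≤1+n (end r))) ⟩
              3 * weight (suc (end r))       ≤⟨ <⇒≤ (≰⇒> ¬qr) ⟩
              3 * weight (end q) + W         ≤⟨ +-monoˡ-≤ W (*-monoʳ-≤ 3 (weight-mono (n≤1+n (end q)))) ⟩
              3 * weight (suc (end q)) + W   ≤⟨ +-monoˡ-≤ W (<⇒≤ (≰⇒> ¬pq)) ⟩
              (3 * weight (end p) + W) + W   ≡⟨ solve 2 (λ u v → (con 3 :* u :+ v) :+ v := con 2 :* v :+ con 3 :* u)
                                                   refl (weight (end p)) W ⟩
              2 * W + 3 * weight (end p)     ≤⟨ +-monoʳ-≤ (2 * W) (*-monoʳ-≤ 3 (weight-mono (n≤1+n (end p)))) ⟩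
              2 * W + 3 * weight (suc (end p)) ∎)
            (begin
              3 * weight (end p) + W   ≤⟨ +-monoˡ-≤ W (<⇒≤ a<W) ⟩
              W + W                     ≡⟨ cong (W +_) (+-identityʳ W) ⟨
              2 * W                     ≤⟨ 2W≤c ⟩
              3 * weight (end r)       ≤⟨ *-monoʳ-≤ 3 (weight-mono (n≤1+n (end r))) ⟩
              3 * weight (suc (end r)) ∎)
      where
      open ≤-Reasoning
      open +-*-Solver using (solve; con; _:+_; _:*_; _:=_)

    private
      -- `(d , x)` encodes the lattice point `(x , d + x)`, which turns the region above the
      -- diagonal into a quadrant.
      Point : Set
      Point = ℕ × ℕ

      path : (p : Point) → RadialPath (proj₂ p) (proj₁ p + proj₂ p)
      path (d , x) = radial d x (d + x) refl

      _∼_ : Point → Point → Set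
      (d , x) ∼ (d′ , x′) = Near x (d + x) x′ (d′ + x′)

      foot : Point → ℕ
      foot p = end (path p)

    foot-bottom : ∀ x → foot (0 , x) ≡ vertex x
    foot-bottom zero    = refl
    foot-bottom (suc x) = refl

    foot-beyond : ∀ d x → top ≤ suc d + suc x → foot (suc d , suc x) ≡ m
    foot-beyond d x top≤ with top ≤? suc d + suc x
    ... | yes _   = refl
    ... | no top≰ = contradiction top≤ top≰

    foot-right : ∀ d x → x ≡ top → foot (d , x) ≡ m
    foot-right zero    x       x≡top = trans (foot-bottom x) (trans (cong vertex x≡top) vertex-top)
    foot-right (suc d) zero    0≡top = trans (cong vertex 0≡top) vertex-top
    foot-right (suc d) (suc x) x≡top =
      foot-beyond d x (≤-trans (≤-reflexive (sym x≡top)) (m≤n+m (suc x) (suc d)))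

    foot-top : 0 < m → ∀ d x → d ≡ top → foot (d , suc x) ≡ m
    foot-top 0<m zero    x 0≡top = contradiction (trans (cong vertex 0≡top) vertex-top) (<⇒≢ 0<m)
    foot-top _   (suc d) x d≡top =
      foot-beyond d x (≤-trans (≤-reflexive (sym d≡top)) (m≤m+n (suc d) (suc x)))

    balanced : 3 ≤ W → HasBalancedSeparation H bound
    -- Sperner's lemma only refutes the absence of a separation; decidability turns this into a
    -- separation.
    balanced 3≤W = decidable-stable (hasBalancedSeparation? H bound) λ ¬sep →
      Sperner.sperner _∼_ near-sym (λ p → hueAt (foot p))
        (λ {p} {q} {r} pq qr pr hp hq hr → ¬sep (rainbowSeparator (path p) (path q) (path r) pq qr pr hp hq hr))
        _,_ horizontal vertical diagonal∼
        -- At `x = top` and, off the left column, at `d = top`, paths end at `m` and have colour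
        -- `c₂`.
        top
        (λ d → ⇒colourOf≡c₀ W (weight 0) (subst (λ u → 3 * u < W) (sym weight-0) (≤-trans (s≤s z≤n) 3≤W)))
        (λ d → trans (cong hueAt (foot-right d top refl)) hue-m)
        (λ x → trans (cong hueAt (foot-top 0<m top x refl)) hue-m)
        up down
      where
      horizontal : ∀ d x → (d , x) ∼ (d , suc x)
      horizontal d x = m≤n⇒m≤1+n (n≤1+n x) , ≤-refl
        , ≤-trans (n≤1+n _) (s≤s (+-monoʳ-≤ d (n≤1+n x))) , ≤-reflexive (+-suc d x)

      vertical : ∀ d x → (d , x) ∼ (suc d , x)
      vertical d x = n≤1+n x , n≤1+n x , m≤n⇒m≤1+n (n≤1+n (d + x)) , ≤-refl

      diagonal∼ : ∀ d x → (suc d , x) ∼ (d , suc x)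
      diagonal∼ d x = m≤n⇒m≤1+n (n≤1+n x) , ≤-refl
        , s≤s (+-monoʳ-≤ d (n≤1+n x)) , ≤-trans (≤-reflexive (+-suc d x)) (n≤1+n _)

      0<m : 0 < m
      0<m = n≢0⇒n>0 λ m≡0 → <⇒≱ (≤-trans (s≤s z≤n) 3≤W)
        (≤-trans weight-m (≤-reflexive (trans (cong weight m≡0) weight-0)))

      hue-m : hueAt m ≡ c₂
      hue-m = ⇒colourOf≡c₂ W (weight m) (*-mono-≤ {2} {3} (n≤1+n 2) weight-m)

      -- One step along the diagonal adds at most one vertex, hence at most 3 to the tripled weight;
      -- skipping the middle third would force `W < 3`.
      up : ∀ x → hueAt (foot (0 , x)) ≡ c₀ → hueAt (foot (0 , suc x)) ≢ c₂
      up x h₀ h₂ = <⇒≱ (+-cancelʳ-< W W 3 (begin-strict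
        W + W                             ≡⟨ cong (W +_) (+-identityʳ W) ⟨
        2 * W                             ≤⟨ colourOf≡c₂⇒ W (weight (foot (0 , suc x))) h₂ ⟩
        3 * weight (foot (0 , suc x))     ≤⟨ *-monoʳ-≤ 3 step ⟩
        3 * suc (weight (foot (0 , x)))   ≡⟨ *-suc 3 _ ⟩
        3 + 3 * weight (foot (0 , x))     <⟨ +-monoʳ-< 3 (colourOf≡c₀⇒ W _ h₀) ⟩
        3 + W                             ∎)) 3≤W
        where
        open ≤-Reasoning
        step : weight (foot (0 , suc x)) ≤ suc (weight (foot (0 , x)))
        step = ≤-trans (weight-mono (≤-trans (≤-reflexive (foot-bottom (suc x))) (≤-trans (vertex-suc x)
          (s≤s (≤-reflexive (sym (foot-bottom x))))))) (weight-suc (foot (0 , x)))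

      down : ∀ x → hueAt (foot (0 , x)) ≡ c₂ → hueAt (foot (0 , suc x)) ≢ c₀
      down x h₂ h₀ = <-irrefl refl (begin-strict
        W                               ≤⟨ m≤n*m W 2 ⟩
        2 * W                           ≤⟨ colourOf≡c₂⇒ W _ h₂ ⟩
        3 * weight (foot (0 , x))       ≤⟨ *-monoʳ-≤ 3 (weight-mono (subst₂ _≤_ (sym (foot-bottom x))
                                             (sym (foot-bottom (suc x))) (vertex-mono (n≤1+n x)))) ⟩
        3 * weight (foot (0 , suc x))   <⟨ colourOf≡c₀⇒ W _ h₀ ⟩
        W                               ∎)
        where open ≤-Reasoning

-- The bound on the separation number.

trivialSeparator : ∀ {n} (H : Graph n) {s} → ∣ V H ∣ ≤ s → HasBalancedSeparation H s
trivialSeparator H V≤s =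
  let _ , _ , separation , small , _ = subgraphsHaveBalancedSeparation-n H H (id , id)
  in V H , V H , separation , small , ≤-trans (∣p∩q∣≤∣p∣ (V H) (V H)) V≤s

theorem14 : ∀ {n : ℕ} (k : ℕ) (G : Graph n) → OuterMinPlanar k G →
    sn G ≤ 2 * ⌊ k /2⌋ + 4
theorem14 k G (D , minPlanar) = proj₂ (sn-isMinimum G) _ separation
  where
  separation : SubgraphsHaveBalancedSeparation G (2 * ⌊ k /2⌋ + 4)
  separation H (V⊆ , Adj⊆) with 3 ≤? ∣ V H ∣
  ... | yes 3≤V = Separators.balanced {G = G} {H} V⊆ Adj⊆ D k minPlanar 3≤V
  -- With fewer than three vertices, all of `V H` fits into the separator, since the bound is at
  -- least 4.
  ... | no 3≰V  = trivialSeparator H (≤-trans (<⇒≤ (≰⇒> 3≰V))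
                    (≤-trans (n≤1+n 3) (m≤n+m 4 (2 * ⌊ k /2⌋))))
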